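{- Let $\mathcal P$ be an integral $d$-simplex with $\delta$-vector $(\delta_0,\ldots,\delta_d)$. If the normalized volume of $\mathcal P$ equals $p$ for a prime number $p$ and $$\min\{i>0:\delta_i\neq0\}=d+1-\max\{i:\delta_i\neq0\},$$ then $\delta(\mathcal P)$ is shifted symmetric.
   Context: For an integral convex polytope $\mathcal P\subset\mathbb R^N$ of dimension $d$, let $i(\mathcal P,n)=|n\mathcal P\cap\mathbb Z^N|$. The $\delta$-vector $\delta(\mathcal P)=(\delta_0,\ldots,\delta_d)$ is defined by $(1-\lambda)^{d+1}\bigl[1+\sum_{n\ge1}i(\mathcal P,n)\lambda^n\bigr]=\sum_{i=0}^d\delta_i\lambda^i$. The normalized volume of $\mathcal P$ is $\sum_{i=0}^d\delta_i$. $\delta(\mathcal P)$ is called shifted symmetric if $\delta_{d-i}=\delta_{i+1}$ for every $0\le i\le\lfloor (d-1)/2\rfloor$. -}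

module Defs where

open import Data.Nat as ℕ using (ℕ; zero; suc; _≤_; _<_; _∸_)
open import Data.Nat.Combinatorics using (_C_)
open import Data.Fin using (Fin; zero; suc)
open import Data.Vec using (Vec; lookup)
open import Data.Integer as ℤ using (ℤ; +_)
open import Data.Rational as ℚ using (ℚ; 0ℚ)
open import Data.List using (List; length)
open import Data.List.Membership.Propositional using (_∈_)
open import Data.List.Relation.Unary.Unique.Propositional using (Unique)
open import Data.Product using (Σ; _×_; ∃)
open import Relation.Binary.PropositionalEquality using (_≡_)
open import Relation.Nullary using (¬_)

Point : ℕ → Set
Point N = Vec ℤ N

toℚ : ℤ → ℚ
toℚ z = z ℚ./ 1

Σℚ : ∀ {m} → (Fin m → ℚ) → ℚ
Σℚ {zero}  f = 0ℚ
Σℚ {suc m} f = f zero ℚ.+ Σℚ (λ i → f (suc i))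

Σℤ[≤_] : ℕ → (ℕ → ℤ) → ℤ
Σℤ[≤ zero ] f  = f 0
Σℤ[≤ suc j ] f = Σℤ[≤ j ] f ℤ.+ f (suc j)

Vertices : ℕ → ℕ → Set
Vertices d N = Fin (suc d) → Point N

AffinelyIndependent : ∀ {d N} → Vertices d N → Set
AffinelyIndependent {d} {N} v =
  (c : Fin (suc d) → ℚ) →
  Σℚ c ≡ 0ℚ →
  ((k : Fin N) → Σℚ (λ i → c i ℚ.* toℚ (lookup (v i) k)) ≡ 0ℚ) →
  (i : Fin (suc d)) → c i ≡ 0ℚ

InDilate : ∀ {d N} → Vertices d N → ℕ → Point N → Set
InDilate {d} {N} v n x =
  Σ (Fin (suc d) → ℚ) λ lam →
    ((i : Fin (suc d)) → 0ℚ ℚ.≤ lam i) ×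
    (Σℚ lam ≡ toℚ (+ n)) ×
    ((k : Fin N) → Σℚ (λ i → lam i ℚ.* toℚ (lookup (v i) k)) ≡ toℚ (lookup x k))

LatticeCount : ∀ {d N} → Vertices d N → ℕ → ℕ → Set
LatticeCount {d} {N} v n k =
  Σ (List (Point N)) λ L →
    Unique L ×
    ((x : Point N) → (x ∈ L → InDilate v n x) × (InDilate v n x → x ∈ L)) ×
    length L ≡ k

ehrCoeff : (ℕ → ℕ) → ℕ → ℤ
ehrCoeff i zero    = + 1
ehrCoeff i (suc n) = + i (suc n)

-- coefficient of λ^j in (1-λ)^{d+1} [1 + Σ_{n≥1} i(n) λ^n]
delta : ℕ → (ℕ → ℕ) → ℕ → ℤ
delta d i j = Σℤ[≤ j ] (λ k → sign k ℤ.* ((+ ((suc d) C k)) ℤ.* ehrCoeff i (j ∸ k)))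
  where
  sign : ℕ → ℤ
  sign zero = + 1
  sign (suc k) = ℤ.- sign k

normVol : ℕ → (ℕ → ℕ) → ℤ
normVol d i = Σℤ[≤ d ] (delta d i)

IsMinPosNonzero : ℕ → (ℕ → ℤ) → ℕ → Set
IsMinPosNonzero d δ a =
  (0 < a) × (a ≤ d) × ¬ (δ a ≡ + 0) ×
  ((j : ℕ) → 0 < j → j < a → δ j ≡ + 0)

IsMaxNonzero : ℕ → (ℕ → ℤ) → ℕ → Set
IsMaxNonzero d δ b =
  (b ≤ d) × ¬ (δ b ≡ + 0) ×
  ((j : ℕ) → b < j → j ≤ d → δ j ≡ + 0)

-- δ_{d-i} = δ_{i+1} for all 0 ≤ i ≤ ⌊(d-1)/2⌋  (i.e. 2i+1 ≤ d)
ShiftedSymmetric : ℕ → (ℕ → ℤ) → Set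
ShiftedSymmetric d δ = (j : ℕ) → suc (2 ℕ.* j) ≤ d → δ (d ∸ j) ≡ δ (suc j)

{-# OPTIONS --safe #-}

-- A lattice point of nP is given by its barycentric coordinates, nonnegative rationals of sum n.  Let f k n
-- count those points whose first k coordinates are < 1.  Subtracting the k-th vertex shows
-- f k (n + 1) − f k n = f (k + 1) (n + 1), so the δ-vector, being the (d+1)-fold difference of f 0, counts
-- the points all of whose coordinates lie in [0,1): δₙ is the number of such "box points" of level n.
-- Modulo 1 the box points form a group of order p.  For each κ, those with vanishing κ-th coordinate form a
-- subgroup, which is therefore trivial or everything.  A box point and its opposite have levels adding up to
-- the number of nonzero coordinates; so if a point of level max had a zero coordinate, its opposite would
-- have positive level at most d − max < min.  Hence all these subgroups are trivial, every nonzero box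
-- point has d + 1 nonzero coordinates, and x ↦ −x matches level n with level d + 1 − n.
module Submission where

open import Defs
open import Data.Nat using (ℕ; suc; _∸_)
open import Data.Nat.Primality using (Prime)
open import Data.Integer using (+_)
open import Data.Product using (Σ; _×_)
open import Relation.Binary.PropositionalEquality using (_≡_)

open import Data.Fin as Fin using (Fin; zero; suc; toℕ; fromℕ<)
import Data.Fin.Properties as Fin
open import Data.Integer as ℤ using (ℤ; -[1+_])
import Data.Integer.Properties as ℤ
open import Data.Integer.Solver using () renaming (module +-*-Solver to ℤ-Solver)
open import Data.List as List using (List; []; _∷_; length; filter; _++_)
open import Data.List.Membership.Propositional using (_∈_)
open import Data.List.Membership.Propositional.Properties
  using (∈-∃++; ∈-++⁻; ∈-++⁺ˡ; ∈-++⁺ʳ; ∈-filter⁺; ∈-filter⁻)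
open import Data.List.Properties using (length-++; filter-accept; filter-reject; filter-complete)
open import Data.List.Relation.Unary.All as All using (All; []; _∷_)
open import Data.List.Relation.Unary.AllPairs using ([]; _∷_)
open import Data.List.Relation.Unary.Any using (here; there)
open import Data.List.Relation.Unary.Unique.Propositional using (Unique)
import Data.List.Relation.Unary.Unique.Propositional.Properties as Unique
open import Data.Maybe using (nothing)
open import Data.Nat as ℕ using (zero; z≤n; s≤s)
import Data.Nat.Properties as ℕ
open import Data.Nat.Combinatorics using (_C_; nCk+nC[k+1]≡[n+1]C[k+1])
open import Data.Nat.Divisibility using (_∣_; _∣0; ∣m∣n⇒∣m+n; ∣-reflexive)
open import Data.Nat.Induction using (<-wellFounded)
open import Data.Nat.Primality using (prime⇒irreducible)
open import Data.Product using (_,_; proj₁; proj₂; ∃)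
open import Data.Rational as ℚ using (ℚ; 0ℚ; 1ℚ; _+_; _*_; _-_; -_; _≤_; _<_; toℚᵘ)
open import Data.Rational.Properties as ℚ
  using (toℚᵘ-injective; toℚᵘ-fromℚᵘ; toℚᵘ-homo-+; toℚᵘ-homo-*; toℚᵘ-homo‿-)
open import Data.Rational.Solver using () renaming (module +-*-Solver to ℚ-Solver)
import Data.Rational.Unnormalised as ℚᵘ
import Data.Rational.Unnormalised.Properties as ℚᵘ
open import Data.Sum using (_⊎_; inj₁; inj₂; [_,_]′)
open import Data.Vec using (Vec; lookup; tabulate)
open import Data.Vec.Properties using (lookup∘tabulate; tabulate∘lookup; tabulate-cong)
open import Function using (_∘_)
open import Induction.WellFounded using (Acc; acc)
open import Level as Universe using (0ℓ)
open import Relation.Binary.Definitions using (DecidableEquality)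
open import Relation.Binary.PropositionalEquality
  using (_≢_; refl; sym; trans; cong; cong₂; subst; subst₂; module ≡-Reasoning)
open import Relation.Nullary using (¬_; yes; no; contradiction)
open import Relation.Nullary.Decidable using (¬?; _→-dec_)
open import Relation.Unary using (Decidable)
import Tactic.RingSolver as RingSolver
open import Tactic.RingSolver.Core.AlmostCommutativeRing using (AlmostCommutativeRing)

-- Enumerations by duplicate-free lists

record Enumerates {A : Set} (P : A → Set) (xs : List A) : Set where
  field
    unique   : Unique xs
    sound    : ∀ {x} → x ∈ xs → P x
    complete : ∀ {x} → P x → x ∈ xs

open Enumerates

-- Relative to `P` because subtraction modulo 1, one of the maps counted with below, is injective
-- only on [0, 1).
InjectiveOn : {A B : Set} → (A → Set) → (A → B) → Set
InjectiveOn P f = ∀ {x y} → P x → P y → f x ≡ f y → x ≡ y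

-- Pigeonhole by induction on `xs`: one occurrence of `f x` is cut out of `ys`, and the images of
-- the other elements survive the cut, since injectivity and uniqueness keep them different from
-- `f x`.
unique-injection-length : {A B : Set} (f : A → B) {xs : List A} {ys : List B} → Unique xs →
  (∀ {x} → x ∈ xs → f x ∈ ys) → InjectiveOn (_∈ xs) f → length xs ℕ.≤ length ys
unique-injection-length f {[]} _ _ _ = z≤n
unique-injection-length f {x ∷ xs} {ys} (x∉ ∷ u) into inj with ∈-∃++ (into (here refl))
... | as , bs , refl = subst (suc (length xs) ℕ.≤_) (sym len) (s≤s ih)
  where
  len : length (as ++ f x ∷ bs) ≡ suc (length (as ++ bs))
  len = begin
    length (as ++ f x ∷ bs)        ≡⟨ length-++ as ⟩
    length as ℕ.+ suc (length bs)  ≡⟨ ℕ.+-suc (length as) (length bs) ⟩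
    suc (length as ℕ.+ length bs)  ≡⟨ cong suc (length-++ as) ⟨
    suc (length (as ++ bs))        ∎
    where open ≡-Reasoning
  into′ : ∀ {y} → y ∈ xs → f y ∈ as ++ bs
  into′ {y} y∈ with ∈-++⁻ as (into (there y∈))
  ... | inj₁ p         = ∈-++⁺ˡ p
  ... | inj₂ (there p) = ∈-++⁺ʳ as p
  ... | inj₂ (here e)  = contradiction (inj (here refl) (there y∈) (sym e)) (All.lookup x∉ y∈)
  ih : length xs ℕ.≤ length (as ++ bs)
  ih = unique-injection-length f u into′ (λ p q → inj (there p) (there q))

module _ {A B : Set} {P : A → Set} {Q : B → Set} {xs : List A} {ys : List B} where

  enumerated-injection-length : Enumerates P xs → Enumerates Q ys → (f : A → B) →
    (∀ {x} → P x → Q (f x)) → InjectiveOn P f → length xs ℕ.≤ length ys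
  enumerated-injection-length ex ey f into inj =
    unique-injection-length f (unique ex) (complete ey ∘ into ∘ sound ex)
      (λ p q → inj (sound ex p) (sound ex q))

enumerated-length : {A : Set} {P Q : A → Set} {xs ys : List A} → Enumerates P xs → Enumerates Q ys →
  (∀ {x} → P x → Q x) → (∀ {x} → Q x → P x) → length xs ≡ length ys
enumerated-length ex ey to from = ℕ.≤-antisym
  (enumerated-injection-length ex ey (λ x → x) to (λ _ _ e → e))
  (enumerated-injection-length ey ex (λ x → x) from (λ _ _ e → e))

filter-enumerates : {A : Set} {P Q : A → Set} (Q? : Decidable Q) {xs : List A} →
  Enumerates P xs → Enumerates (λ x → P x × Q x) (filter Q? xs)
filter-enumerates Q? ex = record
  { unique   = Unique.filter⁺ Q? (unique ex)
  ; sound    = λ x∈ → let x∈xs , q = ∈-filter⁻ Q? x∈ in sound ex x∈xs , q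
  ; complete = λ (p , q) → ∈-filter⁺ Q? (complete ex p) q
  }

module _ {A : Set} {P : A → Set} (P? : Decidable P) where

  length-filter-split : ∀ xs → length xs ≡ length (filter P? xs) ℕ.+ length (filter (¬? ∘ P?) xs)
  length-filter-split []       = refl
  length-filter-split (x ∷ xs) with P? x
  ... | yes _ = cong suc (length-filter-split xs)
  ... | no  _ = trans (cong suc (length-filter-split xs)) (sym (ℕ.+-suc _ _))

  filter-filter : {Q : A → Set} (Q? : Decidable Q) → (∀ {x} → P x → Q x) →
    ∀ xs → filter P? (filter Q? xs) ≡ filter P? xs
  filter-filter Q? P⇒Q []       = refl
  filter-filter Q? P⇒Q (x ∷ xs) with Q? x
  ... | no ¬q = trans (filter-filter Q? P⇒Q xs) (sym (filter-reject P? (¬q ∘ P⇒Q)))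
  ... | yes _ with P? x
  ...   | yes _ = cong (x ∷_) (filter-filter Q? P⇒Q xs)
  ...   | no  _ = filter-filter Q? P⇒Q xs

module _ {A B : Set} (_≟_ : DecidableEquality B) (f : A → B) where

  fibre : A → List A → List A
  fibre x = filter (λ y → f y ≟ f x)

  -- Strong induction on the length: the whole fibre of the first element is removed, which leaves
  -- every other fibre intact. With cosets as fibres this gives Lagrange's theorem in
  -- `vanishing-divides`.
  equal-fibres-divide : ∀ m xs → (∀ {x} → x ∈ xs → length (fibre x xs) ≡ m) → m ∣ length xs
  equal-fibres-divide m xs₀ = go xs₀ (<-wellFounded _)
    where
    go : ∀ xs → Acc ℕ._<_ (length xs) → (∀ {x} → x ∈ xs → length (fibre x xs) ≡ m) → m ∣ length xs
    go [] _ _ = m ∣0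
    go (x ∷ xs) (acc rs) eq = subst (m ∣_) (sym (length-filter-split ≈x? (x ∷ xs)))
        (∣m∣n⇒∣m+n (∣-reflexive (sym (eq (here refl)))) (go rest (rs rest<) eq′))
      where
      ≈x? : Decidable (λ y → f y ≡ f x)
      ≈x? y = f y ≟ f x
      rest : List A
      rest = filter (¬? ∘ ≈x?) (x ∷ xs)
      rest< : length rest ℕ.< length (x ∷ xs)
      -- The fibre of `x` contains `x` itself, so removing it shortens the list.
      rest< = subst (length rest ℕ.<_) (sym (length-filter-split ≈x? (x ∷ xs)))
        (subst (λ l → length rest ℕ.< length l ℕ.+ length rest) (sym (filter-accept ≈x? refl))
          (s≤s (ℕ.m≤n+m _ _)))
      eq′ : ∀ {y} → y ∈ rest → length (fibre y rest) ≡ m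
      eq′ {y} y∈ = let y∈xs , fy≢ = ∈-filter⁻ (¬? ∘ ≈x?) {xs = x ∷ xs} y∈ in
        trans (cong length (filter-filter (λ z → f z ≟ f y) (¬? ∘ ≈x?)
                 (λ fz≡fy fz≡fx → fy≢ (trans (sym fz≡fy) fz≡fx)) (x ∷ xs)))
              (eq y∈xs)

lookup-ext : ∀ {A : Set} {n} {xs ys : Vec A n} → (∀ i → lookup xs i ≡ lookup ys i) → xs ≡ ys
lookup-ext {xs = xs} {ys} e = trans (sym (tabulate∘lookup xs)) (trans (tabulate-cong e) (tabulate∘lookup ys))

enumerates-resp : {A : Set} {P Q : A → Set} {xs : List A} → (∀ {x} → P x → Q x) → (∀ {x} → Q x → P x) →
  Enumerates P xs → Enumerates Q xs
enumerates-resp to from ex = record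
  { unique = unique ex ; sound = to ∘ sound ex ; complete = complete ex ∘ from }

length≡1⇒≡ : {A : Set} {xs : List A} {x y : A} → length xs ≡ 1 → x ∈ xs → y ∈ xs → x ≡ y
length≡1⇒≡ {xs = _ ∷ []} _ (here refl) (here refl) = refl

length≢0⇒∃ : {A : Set} (xs : List A) → length xs ≢ 0 → ∃ λ x → x ∈ xs
length≢0⇒∃ []      ≢0 = contradiction refl ≢0
length≢0⇒∃ (x ∷ _) _  = x , here refl

length≡0⇒∉ : {A : Set} {xs : List A} {x : A} → length xs ≡ 0 → ¬ x ∈ xs
length≡0⇒∉ {xs = []} _ ()

concatUpTo : {A : Set} → (ℕ → List A) → ℕ → List A
concatUpTo xs zero    = xs 0
concatUpTo xs (suc n) = concatUpTo xs n ++ xs (suc n)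

length-concatUpTo : {A : Set} (xs : ℕ → List A) → ∀ n →
  + length (concatUpTo xs n) ≡ Σℤ[≤ n ] (λ j → + length (xs j))
length-concatUpTo xs zero    = refl
length-concatUpTo xs (suc n) = begin
  + length (concatUpTo xs n ++ xs (suc n))              ≡⟨ cong +_ (length-++ (concatUpTo xs n)) ⟩
  + (length (concatUpTo xs n) ℕ.+ length (xs (suc n)))  ≡⟨ ℤ.pos-+ _ (length (xs (suc n))) ⟩
  + length (concatUpTo xs n) ℤ.+ + length (xs (suc n))  ≡⟨ cong (ℤ._+ + length (xs (suc n))) (length-concatUpTo xs n) ⟩
  Σℤ[≤ suc n ] (λ j → + length (xs j))                  ∎
  where open ≡-Reasoning

concatUpTo-enumerates : {A : Set} {P : ℕ → A → Set} {xs : ℕ → List A} →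
  (∀ {m n x} → P m x → P n x → m ≡ n) → (∀ n → Enumerates (P n) (xs n)) →
  ∀ n → Enumerates (λ x → ∃ λ j → j ℕ.≤ n × P j x) (concatUpTo xs n)
concatUpTo-enumerates disj ex zero = enumerates-resp (λ p → 0 , z≤n , p) (λ { (zero , _ , p) → p }) (ex 0)
concatUpTo-enumerates {P = P} {xs} disj ex (suc n) = record
  { unique = Unique.++⁺ (unique ih) (unique (ex (suc n))) (λ (x∈l , x∈r) → disjoint (sound ih x∈l) (sound (ex (suc n)) x∈r))
  ; sound = λ x∈ → from-++ (∈-++⁻ (concatUpTo xs n) x∈)
  ; complete = λ (j , j≤ , p) → to-++ j j≤ p
  }
  where
  ih = concatUpTo-enumerates disj ex n
  disjoint : ∀ {x} → (∃ λ j → j ℕ.≤ n × P j x) → ¬ P (suc n) x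
  disjoint (j , j≤n , p) q = ℕ.<⇒≢ (s≤s j≤n) (disj p q)
  from-++ : ∀ {x} → x ∈ concatUpTo xs n ⊎ x ∈ xs (suc n) → ∃ λ j → j ℕ.≤ suc n × P j x
  from-++ (inj₁ x∈) = let j , j≤n , p = sound ih x∈ in j , ℕ.m≤n⇒m≤1+n j≤n , p
  from-++ (inj₂ x∈) = suc n , ℕ.≤-refl , sound (ex (suc n)) x∈
  to-++ : ∀ {x} j → j ℕ.≤ suc n → P j x → x ∈ concatUpTo xs (suc n)
  to-++ j j≤ p with ℕ.m≤n⇒m<n∨m≡n j≤
  ... | inj₁ (s≤s j≤n) = ∈-++⁺ˡ (complete ih (j , j≤n , p))
  ... | inj₂ refl      = ∈-++⁺ʳ (concatUpTo xs n) (complete (ex (suc n)) p)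

module _ {A B : Set} {P : A → Set} (f : ∀ x → P x → B) where

  -- The map takes a proof argument because barycentric coordinates are read off from the proof that
  -- a point lies in the dilate.
  image : ∀ {xs} → All P xs → List B
  image = All.reduce (λ {x} → f x)

  ∈-image⁻ : ∀ {xs b} (ps : All P xs) → b ∈ image ps → ∃ λ x → x ∈ xs × Σ (P x) λ p → b ≡ f x p
  ∈-image⁻ (p ∷ ps) (here e)   = _ , here refl , p , e
  ∈-image⁻ (p ∷ ps) (there b∈) = let x , x∈ , q , e = ∈-image⁻ ps b∈ in x , there x∈ , q , e

  -- The proof returned is the one stored in `ps` and cannot be prescribed; `agree` in
  -- `level-enumeration` absorbs this choice.
  ∈-image⁺ : ∀ {xs x} (ps : All P xs) → x ∈ xs → Σ (P x) λ p → f x p ∈ image ps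
  ∈-image⁺ (p ∷ ps) (here refl) = p , here refl
  ∈-image⁺ (p ∷ ps) (there x∈)  = let q , q∈ = ∈-image⁺ ps x∈ in q , there q∈

  length-image : ∀ {xs} (ps : All P xs) → length (image ps) ≡ length xs
  length-image []       = refl
  length-image (p ∷ ps) = cong suc (length-image ps)

  image-unique : (∀ x y (p : P x) (q : P y) → f x p ≡ f y q → x ≡ y) →
    ∀ {xs} (ps : All P xs) → Unique xs → Unique (image ps)
  image-unique inj [] _ = []
  image-unique inj {x ∷ xs} (p ∷ ps) (x∉ ∷ u) =
      All.tabulate (λ b∈ → fresh (∈-image⁻ ps b∈)) ∷ image-unique inj ps u
    where
    fresh : ∀ {b} → (∃ λ y → y ∈ xs × Σ (P y) λ q → b ≡ f y q) → f x p ≢ b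
    fresh (y , y∈ , q , refl) e = All.lookup x∉ y∈ (inj x y p q e)

-- The δ-vector as an iterated difference

Σℤ-cong : ∀ j {f g : ℕ → ℤ} → (∀ k → f k ≡ g k) → Σℤ[≤ j ] f ≡ Σℤ[≤ j ] g
Σℤ-cong zero    e = e 0
Σℤ-cong (suc j) e = cong₂ ℤ._+_ (Σℤ-cong j e) (e (suc j))

Σℤ-distrib-- : ∀ j (f g : ℕ → ℤ) → Σℤ[≤ j ] (λ k → f k ℤ.- g k) ≡ Σℤ[≤ j ] f ℤ.- Σℤ[≤ j ] g
Σℤ-distrib-- zero    f g = refl
Σℤ-distrib-- (suc j) f g = trans (cong (ℤ._+ (f (suc j) ℤ.- g (suc j))) (Σℤ-distrib-- j f g))
  (solve 4 (λ a b c d → a :- b :+ (c :- d) := a :+ c :- (b :+ d)) refl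
    (Σℤ[≤ j ] f) (Σℤ[≤ j ] g) (f (suc j)) (g (suc j)))
  where open ℤ-Solver

Σℤ-0 : ∀ j {f : ℕ → ℤ} → (∀ k → f k ≡ + 0) → Σℤ[≤ j ] f ≡ + 0
Σℤ-0 zero    e = e 0
Σℤ-0 (suc j) e = cong₂ ℤ._+_ (Σℤ-0 j e) (e (suc j))

Σℤ-first : ∀ j (f : ℕ → ℤ) → Σℤ[≤ suc j ] f ≡ f 0 ℤ.+ Σℤ[≤ j ] (λ k → f (suc k))
Σℤ-first zero    f = refl
Σℤ-first (suc j) f = trans (cong (ℤ._+ f (suc (suc j))) (Σℤ-first j f)) (ℤ.+-assoc (f 0) _ _)

-- Multiplication of the generating function by 1 - λ; the first clause reflects the value 0 at
-- index -1.
∇ : (ℕ → ℤ) → ℕ → ℤ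
∇ e zero    = e 0
∇ e (suc n) = e (suc n) ℤ.- e n

∇^ : ℕ → (ℕ → ℤ) → ℕ → ℤ
∇^ zero    e = e
∇^ (suc m) e = ∇ (∇^ m e)

module _ (sgn : ℕ → ℤ) (sgn-0 : sgn 0 ≡ + 1) (sgn-suc : ∀ k → sgn (suc k) ≡ ℤ.- sgn k) (e : ℕ → ℤ) where

  term : ℕ → ℕ → ℕ → ℤ
  term m j k = sgn k ℤ.* (+ (m C k) ℤ.* e (j ∸ k))

  term-0 : ∀ m j → term m j 0 ≡ e j
  term-0 m j = trans (cong (ℤ._* (+ 1 ℤ.* e j)) sgn-0) (trans (ℤ.*-identityˡ _) (ℤ.*-identityˡ _))

  term-pascal : ∀ m j k → term (suc m) (suc j) (suc k) ≡ term m (suc j) (suc k) ℤ.- term m j k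
  term-pascal m j k rewrite sgn-suc k | sym (nCk+nC[k+1]≡[n+1]C[k+1] m k) | ℤ.pos-+ (m C k) (m C suc k) =
    solve 4 (λ s c c′ x → (:- s) :* ((c :+ c′) :* x) := (:- s) :* (c′ :* x) :- s :* (c :* x)) refl
      (sgn k) (+ (m C k)) (+ (m C suc k)) (e (j ∸ k))
    where open ℤ-Solver

  -- Induction on `m`, one factor 1 - λ at a time: Pascal's rule splits the sum for `suc m` into the
  -- sums for `m` at `suc j` and at `j`, the latter with a minus sign.
  alternating-binomial-sum : ∀ m j → Σℤ[≤ j ] (term m j) ≡ ∇^ m e j
  alternating-binomial-sum zero    zero    = term-0 0 0
  alternating-binomial-sum zero    (suc j) = begin
    Σℤ[≤ suc j ] (term 0 (suc j))                               ≡⟨ Σℤ-first j (term 0 (suc j)) ⟩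
    -- `0 C suc k` computes to 0, so only the term at `k = 0` survives.
    term 0 (suc j) 0 ℤ.+ Σℤ[≤ j ] (λ k → term 0 (suc j) (suc k)) ≡⟨ cong₂ ℤ._+_ (term-0 0 (suc j)) (Σℤ-0 j (λ k → ℤ.*-zeroʳ (sgn (suc k)))) ⟩
    e (suc j) ℤ.+ + 0                                           ≡⟨ ℤ.+-identityʳ _ ⟩
    e (suc j)                                                   ∎
    where open ≡-Reasoning
  alternating-binomial-sum (suc m) zero    =
    trans (term-0 (suc m) 0) (trans (sym (term-0 m 0)) (alternating-binomial-sum m zero))
  alternating-binomial-sum (suc m) (suc j) = begin
    Σℤ[≤ suc j ] (term (suc m) (suc j))
      ≡⟨ Σℤ-first j (term (suc m) (suc j)) ⟩
    term (suc m) (suc j) 0 ℤ.+ Σℤ[≤ j ] (λ k → term (suc m) (suc j) (suc k))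
      ≡⟨ cong₂ ℤ._+_ (trans (term-0 (suc m) (suc j)) (sym (term-0 m (suc j))))
          (trans (Σℤ-cong j (term-pascal m j)) (Σℤ-distrib-- j (λ k → term m (suc j) (suc k)) (term m j))) ⟩
    term m (suc j) 0 ℤ.+ (Σℤ[≤ j ] (λ k → term m (suc j) (suc k)) ℤ.- Σℤ[≤ j ] (term m j))
      ≡⟨ ℤ.+-assoc (term m (suc j) 0) _ _ ⟨
    term m (suc j) 0 ℤ.+ Σℤ[≤ j ] (λ k → term m (suc j) (suc k)) ℤ.- Σℤ[≤ j ] (term m j)
      ≡⟨ cong₂ ℤ._-_ (trans (sym (Σℤ-first j (term m (suc j)))) (alternating-binomial-sum m (suc j)))
          (alternating-binomial-sum m j) ⟩
    ∇^ m e (suc j) ℤ.- ∇^ m e j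
      ∎
    where open ≡-Reasoning


-- The local function `sign` of `delta` cannot be named here, and unification cannot recover it, since
-- ℤ._*_ unfolds.  The ring solver, however, parses the summand sign k * (…) syntactically.  It is run over
-- a ring whose "equality" Trace x y is inhabited for all x and y and merely carries an integer: reflexivity
-- carries its endpoint and congruence keeps the left factor, so that the solver's proof evaluates to sign k.
record Trace (x y : ℤ) : Set where
  constructor trace
  field traced : ℤ

open Trace

traceRing : AlmostCommutativeRing 0ℓ 0ℓ
traceRing = record
  { Carrier = ℤ
  ; _≈_ = Trace
  ; _+_ = ℤ._+_
  ; _*_ = ℤ._*_
  ; -_  = ℤ.-_
  ; 0#  = + 0
  ; 0≟_ = λ _ → nothing
  ; 1#  = + 1
  ; isAlmostCommutativeRing = record
    { isCommutativeSemiring = record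
      { isSemiring = record
        { isSemiringWithoutAnnihilatingZero = record
          { +-isCommutativeMonoid = record
            { isMonoid = record
              { isSemigroup = record
                { isMagma = record
                  { isEquivalence = record
                    { refl  = λ {x} → trace x
                    ; sym   = λ t → trace (traced t)
                    ; trans = λ _ t → trace (traced t)
                    }
                  ; ∙-cong = λ t _ → trace (traced t)
                  }
                ; assoc = λ _ _ _ → trace (+ 0)
                }
              ; identity = (λ _ → trace (+ 0)) , (λ _ → trace (+ 0))
              }
            ; comm = λ _ _ → trace (+ 0)
            }
          ; *-cong     = λ t _ → trace (traced t)
          ; *-assoc    = λ _ _ _ → trace (+ 0)
          ; *-identity = (λ _ → trace (+ 0)) , (λ _ → trace (+ 0))
          ; distrib    = (λ _ _ _ → trace (+ 0)) , (λ _ _ _ → trace (+ 0))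
          }
        ; zero = (λ _ → trace (+ 0)) , (λ _ → trace (+ 0))
        }
      ; *-comm = λ _ _ → trace (+ 0)
      }
    ; -‿cong       = λ t → trace (traced t)
    ; -‿*-distribˡ = λ _ _ → trace (+ 0)
    ; -‿+-comm     = λ _ _ → trace (+ 0)
    }
  }

-- The unused integer argument of t serves as the variable that the solver has to be given.
traced-alternating-sum : ∀ m j (e F : ℕ → ℤ) (t : ∀ k → ℤ → Trace (F k) (F k)) →
  traced (t 0 (+ 0)) ≡ + 1 → (∀ k → traced (t (suc k) (+ 0)) ≡ ℤ.- traced (t k (+ 0))) →
  (∀ k → F k ≡ traced (t k (+ 0)) ℤ.* (+ (m C k) ℤ.* e (j ∸ k))) →
  Σℤ[≤ j ] F ≡ ∇^ m e j
traced-alternating-sum m j e F t t-0 t-suc F≡ =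
  trans (Σℤ-cong j F≡) (alternating-binomial-sum (λ k → traced (t k (+ 0))) t-0 t-suc e m j)

-- Unification with the goal finds `F`, the summand of `delta`; the solver's proofs serve as `t`,
-- and the three conditions on the traced sign hold by evaluation.
delta-∇ : ∀ d i j → delta d i j ≡ ∇^ (suc d) (ehrCoeff i) j
delta-∇ d i j = traced-alternating-sum (suc d) j (ehrCoeff i) _
  (λ k z → RingSolver.solve (z List.∷ List.[]) traceRing) refl (λ _ → refl) (λ _ → refl)

-- Rational numbers

open ℚ-Solver

toℚᵘ-toℚ : ∀ z → toℚᵘ (toℚ z) ℚᵘ.≃ ℚᵘ.mkℚᵘ z 0
toℚᵘ-toℚ z = toℚᵘ-fromℚᵘ (ℚᵘ.mkℚᵘ z 0)

toℚ-homo-+ : ∀ x y → toℚ (x ℤ.+ y) ≡ toℚ x + toℚ y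
toℚ-homo-+ x y = toℚᵘ-injective (begin
  toℚᵘ (toℚ (x ℤ.+ y))                ≈⟨ toℚᵘ-toℚ (x ℤ.+ y) ⟩
  ℚᵘ.mkℚᵘ (x ℤ.+ y) 0                 ≡⟨ cong₂ (λ a b → ℚᵘ.mkℚᵘ (a ℤ.+ b) 0) (ℤ.*-identityʳ x) (ℤ.*-identityʳ y) ⟨
  ℚᵘ.mkℚᵘ x 0 ℚᵘ.+ ℚᵘ.mkℚᵘ y 0        ≈⟨ ℚᵘ.+-cong (toℚᵘ-toℚ x) (toℚᵘ-toℚ y) ⟨
  toℚᵘ (toℚ x) ℚᵘ.+ toℚᵘ (toℚ y)      ≈⟨ toℚᵘ-homo-+ (toℚ x) (toℚ y) ⟨
  toℚᵘ (toℚ x + toℚ y)                ∎)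
  where open ℚᵘ.≃-Reasoning

toℚ-homo-* : ∀ x y → toℚ (x ℤ.* y) ≡ toℚ x * toℚ y
toℚ-homo-* x y = toℚᵘ-injective (begin
  toℚᵘ (toℚ (x ℤ.* y))                ≈⟨ toℚᵘ-toℚ (x ℤ.* y) ⟩
  ℚᵘ.mkℚᵘ x 0 ℚᵘ.* ℚᵘ.mkℚᵘ y 0        ≈⟨ ℚᵘ.*-cong (toℚᵘ-toℚ x) (toℚᵘ-toℚ y) ⟨
  toℚᵘ (toℚ x) ℚᵘ.* toℚᵘ (toℚ y)      ≈⟨ toℚᵘ-homo-* (toℚ x) (toℚ y) ⟨
  toℚᵘ (toℚ x * toℚ y)                ∎)
  where open ℚᵘ.≃-Reasoning

toℚ-homo‿- : ∀ x → toℚ (ℤ.- x) ≡ - toℚ x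
toℚ-homo‿- x = toℚᵘ-injective (begin
  toℚᵘ (toℚ (ℤ.- x))                  ≈⟨ toℚᵘ-toℚ (ℤ.- x) ⟩
  ℚᵘ.- ℚᵘ.mkℚᵘ x 0                    ≈⟨ ℚᵘ.-‿cong (toℚᵘ-toℚ x) ⟨
  ℚᵘ.- toℚᵘ (toℚ x)                   ≈⟨ toℚᵘ-homo‿- (toℚ x) ⟨
  toℚᵘ (- toℚ x)                      ∎)
  where open ℚᵘ.≃-Reasoning

toℚ-cancel-≤ : ∀ {x y} → toℚ x ≤ toℚ y → x ℤ.≤ y
toℚ-cancel-≤ {x} {y} x≤y = subst₂ ℤ._≤_ (ℤ.*-identityʳ x) (ℤ.*-identityʳ y)
  (ℚᵘ.drop-*≤* (ℚᵘ.≤-respˡ-≃ (toℚᵘ-toℚ x) (ℚᵘ.≤-respʳ-≃ (toℚᵘ-toℚ y) (ℚ.toℚᵘ-mono-≤ x≤y))))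

toℚ-cancel-< : ∀ {x y} → toℚ x < toℚ y → x ℤ.< y
toℚ-cancel-< {x} {y} x<y = subst₂ ℤ._<_ (ℤ.*-identityʳ x) (ℤ.*-identityʳ y)
  (ℚᵘ.drop-*<* (ℚᵘ.<-respˡ-≃ (toℚᵘ-toℚ x) (ℚᵘ.<-respʳ-≃ (toℚᵘ-toℚ y) (ℚ.toℚᵘ-mono-< x<y))))

toℚ-injective : ∀ {x y} → toℚ x ≡ toℚ y → x ≡ y
toℚ-injective e = ℤ.≤-antisym (toℚ-cancel-≤ (ℚ.≤-reflexive e)) (toℚ-cancel-≤ (ℚ.≤-reflexive (sym e)))

p-[p-q]≡q : ∀ p q → p - (p - q) ≡ q
p-[p-q]≡q = solve 2 (λ p q → p :- (p :- q) := q) refl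

Σℚ-cong : ∀ {m} {f g : Fin m → ℚ} → (∀ i → f i ≡ g i) → Σℚ f ≡ Σℚ g
Σℚ-cong {zero}  e = refl
Σℚ-cong {suc m} e = cong₂ _+_ (e zero) (Σℚ-cong (λ i → e (suc i)))

Σℚ-distrib-+ : ∀ {m} (f g : Fin m → ℚ) → Σℚ (λ i → f i + g i) ≡ Σℚ f + Σℚ g
Σℚ-distrib-+ {zero}  f g = refl
Σℚ-distrib-+ {suc m} f g = trans (cong (λ s → f zero + g zero + s) (Σℚ-distrib-+ (λ i → f (suc i)) (λ i → g (suc i))))
  (solve 4 (λ a b c d → (a :+ b) :+ (c :+ d) := (a :+ c) :+ (b :+ d)) refl (f zero) (g zero) (Σℚ (λ i → f (suc i))) (Σℚ (λ i → g (suc i))))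

Σℚ-neg : ∀ {m} (f : Fin m → ℚ) → Σℚ (λ i → - f i) ≡ - Σℚ f
Σℚ-neg {zero}  f = refl
Σℚ-neg {suc m} f = trans (cong (λ s → - f zero + s) (Σℚ-neg (λ i → f (suc i))))
  (sym (ℚ.neg-distrib-+ (f zero) (Σℚ (λ i → f (suc i)))))

Σℚ-distrib-- : ∀ {m} (f g : Fin m → ℚ) → Σℚ (λ i → f i - g i) ≡ Σℚ f - Σℚ g
Σℚ-distrib-- f g = trans (Σℚ-distrib-+ f (λ i → - g i)) (cong (λ s → Σℚ f + s) (Σℚ-neg g))

Σℚ-mono-≤ : ∀ {m} {f g : Fin m → ℚ} → (∀ i → f i ≤ g i) → Σℚ f ≤ Σℚ g
Σℚ-mono-≤ {zero}  e = ℚ.≤-refl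
Σℚ-mono-≤ {suc m} e = ℚ.+-mono-≤ (e zero) (Σℚ-mono-≤ (λ i → e (suc i)))

Σℚ-0 : ∀ m → Σℚ {m} (λ _ → 0ℚ) ≡ 0ℚ
Σℚ-0 zero    = refl
Σℚ-0 (suc m) = cong (λ s → 0ℚ + s) (Σℚ-0 m)

Σℚ-1 : ∀ m → Σℚ {m} (λ _ → 1ℚ) ≡ toℚ (+ m)
Σℚ-1 zero    = refl
Σℚ-1 (suc m) = trans (cong (λ s → 1ℚ + s) (Σℚ-1 m)) (sym (toℚ-homo-+ (+ 1) (+ m)))

Σℚ-nonNeg : ∀ {m} {f : Fin m → ℚ} → (∀ i → 0ℚ ≤ f i) → 0ℚ ≤ Σℚ f
Σℚ-nonNeg {m} {f} f≥0 = subst (_≤ Σℚ f) (Σℚ-0 m) (Σℚ-mono-≤ f≥0)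

Σℚ≡0⇒≡0 : ∀ {m} {f : Fin m → ℚ} → (∀ i → 0ℚ ≤ f i) → Σℚ f ≡ 0ℚ → ∀ i → f i ≡ 0ℚ
Σℚ≡0⇒≡0 {suc m} {f} f≥0 Σ≡0 zero = ℚ.≤-antisym
  (subst₂ _≤_ (ℚ.+-identityʳ (f zero)) Σ≡0 (ℚ.+-monoʳ-≤ (f zero) (Σℚ-nonNeg (λ i → f≥0 (suc i))))) (f≥0 zero)
Σℚ≡0⇒≡0 {suc m} {f} f≥0 Σ≡0 (suc i) = Σℚ≡0⇒≡0 (λ j → f≥0 (suc j)) (ℚ.≤-antisym
  (subst₂ _≤_ (ℚ.+-identityˡ _) Σ≡0 (ℚ.+-monoˡ-≤ (Σℚ (λ j → f (suc j))) (f≥0 zero)))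
  (Σℚ-nonNeg (λ j → f≥0 (suc j)))) i

Σℚ-mono-< : ∀ {m} {f g : Fin (suc m) → ℚ} → (∀ i → f i < g i) → Σℚ f < Σℚ g
Σℚ-mono-< e = ℚ.+-mono-<-≤ (e zero) (Σℚ-mono-≤ (λ i → ℚ.<⇒≤ (e (suc i))))

unit : ∀ {m} → Fin m → Fin m → ℚ
unit zero    zero    = 1ℚ
unit zero    (suc _) = 0ℚ
unit (suc _) zero    = 0ℚ
unit (suc i) (suc j) = unit i j

Σℚ-unit : ∀ {m} (κ : Fin m) → Σℚ (unit κ) ≡ 1ℚ
Σℚ-unit {suc m} zero    = cong (λ s → 1ℚ + s) (Σℚ-0 m)
Σℚ-unit {suc m} (suc κ) = trans (ℚ.+-identityˡ _) (Σℚ-unit κ)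

unit-diag : ∀ {m} (κ : Fin m) → unit κ κ ≡ 1ℚ
unit-diag zero    = refl
unit-diag (suc κ) = unit-diag κ

unit-off-diag : ∀ {m} {κ i : Fin m} → κ ≢ i → unit κ i ≡ 0ℚ
unit-off-diag {κ = zero}  {zero}  ≢ = contradiction refl ≢
unit-off-diag {κ = zero}  {suc _} ≢ = refl
unit-off-diag {κ = suc _} {zero}  ≢ = refl
unit-off-diag {κ = suc _} {suc _} ≢ = unit-off-diag (λ e → ≢ (cong suc e))

IsInt : ℚ → Set
IsInt q = ∃ λ z → q ≡ toℚ z

IsInt-0 : IsInt 0ℚ
IsInt-0 = + 0 , refl

IsInt-1 : IsInt 1ℚ
IsInt-1 = + 1 , refl

IsInt-+ : ∀ {p q} → IsInt p → IsInt q → IsInt (p + q)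
IsInt-+ (x , refl) (y , refl) = x ℤ.+ y , sym (toℚ-homo-+ x y)

IsInt-neg : ∀ {p} → IsInt p → IsInt (- p)
IsInt-neg (x , refl) = ℤ.- x , sym (toℚ-homo‿- x)

IsInt-- : ∀ {p q} → IsInt p → IsInt q → IsInt (p - q)
IsInt-- ip iq = IsInt-+ ip (IsInt-neg iq)

IsInt-* : ∀ {p q} → IsInt p → IsInt q → IsInt (p * q)
IsInt-* (x , refl) (y , refl) = x ℤ.* y , sym (toℚ-homo-* x y)

IsInt-Σ : ∀ {m} {f : Fin m → ℚ} → (∀ i → IsInt (f i)) → IsInt (Σℚ f)
IsInt-Σ {zero}  e = IsInt-0
IsInt-Σ {suc m} e = IsInt-+ (e zero) (IsInt-Σ (λ i → e (suc i)))

-- Congruence modulo 1 passes from terms to sums, as Σ g = Σ f - Σ (f - g).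
IsInt-Σ-mod : ∀ {m} (f g : Fin m → ℚ) → (∀ i → IsInt (f i - g i)) → IsInt (Σℚ f) → IsInt (Σℚ g)
IsInt-Σ-mod f g e if = subst IsInt
  (trans (cong (λ s → Σℚ f - s) (Σℚ-distrib-- f g)) (p-[p-q]≡q (Σℚ f) (Σℚ g)))
  (IsInt-- if (IsInt-Σ e))

nonNeg-IsInt : ∀ {q} → IsInt q → 0ℚ ≤ q → ∃ λ n → q ≡ toℚ (+ n)
nonNeg-IsInt (+ n , e) _ = n , e
nonNeg-IsInt (-[1+ n ] , refl) 0≤q with () ← toℚ-cancel-≤ {+ 0} { -[1+ n ]} 0≤q

unit-IsInt : ∀ {m} (κ i : Fin m) → IsInt (unit κ i)
unit-IsInt zero    zero    = IsInt-1
unit-IsInt zero    (suc _) = IsInt-0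
unit-IsInt (suc _) zero    = IsInt-0
unit-IsInt (suc κ) (suc i) = unit-IsInt κ i

-- Subtraction modulo 1

_⊖_ : ℚ → ℚ → ℚ
p ⊖ q with q ℚ.≤? p
... | yes _ = p - q
... | no  _ = p - q + 1ℚ

InUnit : ℚ → Set
InUnit p = (0ℚ ≤ p) × (p < 1ℚ)

≤⇒0≤- : ∀ {p q} → q ≤ p → 0ℚ ≤ p - q
≤⇒0≤- {p} {q} q≤p = subst (_≤ p - q) (ℚ.+-inverseʳ q) (ℚ.+-monoˡ-≤ (- q) q≤p)

<⇒0<- : ∀ {p q} → q < p → 0ℚ < p - q
<⇒0<- {p} {q} q<p = subst (_< p - q) (ℚ.+-inverseʳ q) (ℚ.+-monoˡ-< (- q) q<p)

0<-⇒< : ∀ {p q} → 0ℚ < p - q → q < p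
0<-⇒< {p} {q} h = subst₂ _<_ (ℚ.+-identityˡ q) (solve 2 (λ p q → p :- q :+ q := p) refl p q) (ℚ.+-monoˡ-< q h)

-- The difference `p - q` lies strictly between -1 and 1, so adding 1 exactly when it is negative
-- brings it back to [0, 1).
⊖-InUnit : ∀ {p q} → InUnit p → InUnit q → InUnit (p ⊖ q)
⊖-InUnit {p} {q} (0≤p , p<1) (0≤q , q<1) with q ℚ.≤? p
... | yes q≤p = ≤⇒0≤- q≤p , ℚ.≤-<-trans (subst (p - q ≤_) (ℚ.+-identityʳ p) (ℚ.+-monoʳ-≤ p (ℚ.neg-antimono-≤ 0≤q))) p<1
... | no q≰p =
  subst (0ℚ ≤_) (solve 3 (λ o p q → p :+ (o :- q) := p :- q :+ o) refl 1ℚ p q)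
    (ℚ.+-mono-≤ 0≤p (≤⇒0≤- (ℚ.<⇒≤ q<1))) ,
  0<-⇒< (subst (0ℚ <_) (solve 3 (λ o p q → q :- p := o :- (p :- q :+ o)) refl 1ℚ p q) (<⇒0<- (ℚ.≰⇒> q≰p)))

⊖-IsInt : ∀ p q → IsInt (p - q - (p ⊖ q))
⊖-IsInt p q with q ℚ.≤? p
... | yes _ = subst IsInt (sym (ℚ.+-inverseʳ (p - q))) IsInt-0
... | no  _ = subst IsInt (solve 3 (λ o p q → :- o := p :- q :- (p :- q :+ o)) refl 1ℚ p q) (IsInt-neg IsInt-1)

⊖-self : ∀ p → p ⊖ p ≡ 0ℚ
⊖-self p with p ℚ.≤? p
... | yes _ = ℚ.+-inverseʳ p
... | no ≰ = contradiction ℚ.≤-refl ≰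

⊖-zeroʳ : ∀ {p} → 0ℚ ≤ p → p ⊖ 0ℚ ≡ p
⊖-zeroʳ {p} 0≤p with 0ℚ ℚ.≤? p
... | yes _ = ℚ.+-identityʳ p
... | no ≰ = contradiction 0≤p ≰

⊖-zeroˡ : ∀ {q} → 0ℚ ≤ q → q ≢ 0ℚ → 0ℚ ⊖ q ≡ 1ℚ - q
⊖-zeroˡ {q} 0≤q q≢0 with q ℚ.≤? 0ℚ
... | yes q≤0 = contradiction (ℚ.≤-antisym q≤0 0≤q) q≢0
... | no _ = solve 2 (λ o q → con 0ℚ :- q :+ o := o :- q) refl 1ℚ q

-- Numbers in [0, 1) differ by less than 1 in absolute value, and 0 is the only integer of that
-- size.
IsInt-InUnit-diff : ∀ {p q} → InUnit p → InUnit q → IsInt (p - q) → p ≡ q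
IsInt-InUnit-diff {p} {q} ip iq (z , e) = trans (solve 2 (λ p q → p := p :- q :+ q) refl p q)
  (trans (cong (_+ q) (trans e (cong toℚ (∣ z ∣<1⇒≡0 z<1 -z<1)))) (ℚ.+-identityˡ q))
  where
  diff<1 : ∀ {a b} → InUnit a → InUnit b → a - b < 1ℚ
  diff<1 {a} {b} (_ , a<1) (0≤b , _) = subst (a - b <_) (ℚ.+-identityʳ 1ℚ) (ℚ.+-mono-<-≤ a<1 (ℚ.neg-antimono-≤ 0≤b))
  z<1 : z ℤ.< + 1
  z<1 = toℚ-cancel-< (subst (_< 1ℚ) e (diff<1 ip iq))
  -z<1 : ℤ.- z ℤ.< + 1
  -z<1 = toℚ-cancel-< (subst (_< 1ℚ)
    (trans (solve 2 (λ p q → q :- p := :- (p :- q)) refl p q) (trans (cong -_ e) (sym (toℚ-homo‿- z)))) (diff<1 iq ip))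
  ∣_∣<1⇒≡0 : ∀ x → x ℤ.< + 1 → ℤ.- x ℤ.< + 1 → x ≡ + 0
  ∣ + zero   ∣<1⇒≡0 _ _ = refl
  ∣ + suc n  ∣<1⇒≡0 (ℤ.+<+ (s≤s ())) _
  ∣ -[1+ n ] ∣<1⇒≡0 _ (ℤ.+<+ (s≤s ()))

-- The common value cancels in the difference of the two integers supplied by `⊖-IsInt`, so `q - r`
-- is an integer.
⊖-injectiveʳ : ∀ {p q r} → InUnit q → InUnit r → p ⊖ q ≡ p ⊖ r → q ≡ r
⊖-injectiveʳ {p} {q} {r} iq ir e = IsInt-InUnit-diff iq ir (subst IsInt
  (trans (cong (λ s → p - r - s - (p - q - (p ⊖ q))) (sym e))
    (solve 4 (λ p q r s → p :- r :- s :- (p :- q :- s) := q :- r) refl p q r (p ⊖ q)))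
  (IsInt-- (⊖-IsInt p r) (⊖-IsInt p q)))

⊖-injectiveˡ : ∀ {p q r} → InUnit p → InUnit q → p ⊖ r ≡ q ⊖ r → p ≡ q
⊖-injectiveˡ {p} {q} {r} ip iq e = IsInt-InUnit-diff ip iq (subst IsInt
  (trans (cong (λ s → p - r - (p ⊖ r) - (q - r - s)) (sym e))
    (solve 4 (λ p q r s → p :- r :- s :- (q :- r :- s) := p :- q) refl p q r (p ⊖ r)))
  (IsInt-- (⊖-IsInt p r) (⊖-IsInt q r)))

-- Barycentric coordinates

module _ {d N : ℕ} (v : Vertices d N) where

  Coords : Set
  Coords = Fin (suc d) → ℚ

  vertex : Fin N → Fin (suc d) → ℚ
  vertex k i = toℚ (lookup (v i) k)

  combination : Coords → Fin N → ℚ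
  combination c k = Σℚ (λ i → c i * vertex k i)

  record Lattice (c : Coords) : Set where
    constructor mkLattice
    field integral : ∀ k → IsInt (combination c k)

  -- The lattice point itself is not recorded; it is recovered from its coordinates as
  -- `combination c`.
  record Level (n : ℕ) (c : Coords) : Set where
    constructor mkLevel
    field
      nonNegative : ∀ i → 0ℚ ≤ c i
      total       : Σℚ c ≡ toℚ (+ n)
      lattice     : Lattice c

  open Lattice
  open Level

  combination-- : ∀ c c′ k → combination (λ i → c i - c′ i) k ≡ combination c k - combination c′ k
  combination-- c c′ k = trans
    (Σℚ-cong (λ i → solve 3 (λ x y z → (x :- y) :* z := x :* z :- y :* z) refl (c i) (c′ i) (vertex k i)))
    (Σℚ-distrib-- (λ i → c i * vertex k i) (λ i → c′ i * vertex k i))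

  combination-cong : ∀ {c c′} → (∀ i → c i ≡ c′ i) → ∀ k → combination c k ≡ combination c′ k
  combination-cong e k = Σℚ-cong (λ i → cong (_* vertex k i) (e i))

  Lattice-resp : ∀ {c c′} → (∀ i → c i ≡ c′ i) → Lattice c → Lattice c′
  Lattice-resp e l .integral k = subst IsInt (combination-cong e k) (integral l k)

  -- The vertices are integral, so changing the coefficients by integers moves the combination by an
  -- integral vector.
  Lattice-mod : ∀ {c c′} → (∀ i → IsInt (c i - c′ i)) → Lattice c → Lattice c′
  Lattice-mod {c} {c′} e l .integral k = IsInt-Σ-mod (λ i → c i * vertex k i) (λ i → c′ i * vertex k i)
    (λ i → subst IsInt (solve 3 (λ x y z → (x :- y) :* z := x :* z :- y :* z) refl (c i) (c′ i) (vertex k i))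
      (IsInt-* (e i) (lookup (v i) k , refl))) (integral l k)

  Lattice-- : ∀ {c c′} → Lattice c → Lattice c′ → Lattice (λ i → c i - c′ i)
  Lattice-- {c} {c′} l l′ .integral k =
    subst IsInt (sym (combination-- c c′ k)) (IsInt-- (integral l k) (integral l′ k))

  Level-resp : ∀ {n c c′} → (∀ i → c i ≡ c′ i) → Level n c → Level n c′
  Level-resp e (mkLevel nn s l) = mkLevel
    (λ i → subst (0ℚ ≤_) (e i) (nn i)) (trans (sym (Σℚ-cong e)) s) (Lattice-resp e l)

  Level-unique : ∀ {m n c} → Level m c → Level n c → m ≡ n
  Level-unique {m} {n} l l′ = ℤ.+-injective (toℚ-injective {+ m} {+ n} (trans (sym (total l)) (total l′)))

  Level0⇒≡0 : ∀ {c} → Level 0 c → ∀ i → c i ≡ 0ℚ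
  Level0⇒≡0 l = Σℚ≡0⇒≡0 (nonNegative l) (total l)

  ≡0⇒Level0 : ∀ {c} → (∀ i → c i ≡ 0ℚ) → Level 0 c
  ≡0⇒Level0 e = Level-resp (sym ∘ e) (mkLevel (λ _ → ℚ.≤-refl) (Σℚ-0 (suc d))
    (mkLattice (λ k → subst IsInt
      (sym (trans (Σℚ-cong {suc d} (λ i → ℚ.*-zeroˡ (vertex k i))) (Σℚ-0 (suc d)))) IsInt-0)))

  module _ (indep : AffinelyIndependent v) where

    coords-unique : ∀ c c′ → Σℚ c ≡ Σℚ c′ → (∀ k → combination c k ≡ combination c′ k) → ∀ i → c i ≡ c′ i
    coords-unique c c′ s e i = trans (solve 2 (λ x y → x := x :- y :+ y) refl (c i) (c′ i))
      (trans (cong (_+ c′ i) (indep (λ i → c i - c′ i)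
          (trans (Σℚ-distrib-- c c′) (diff≡0 s))
          (λ k → trans (combination-- c c′ k) (diff≡0 (e k))) i))
        (ℚ.+-identityˡ (c′ i)))
      where
      diff≡0 : ∀ {a b} → a ≡ b → a - b ≡ 0ℚ
      diff≡0 {a} refl = ℚ.+-inverseʳ a

    -- Passing from points to coordinates is injective because coordinates determine the point. It
    -- reaches every tuple of level `n` because affine independence makes the coordinates of a point
    -- unique.
    level-enumeration : ∀ n {k} → LatticeCount v n k →
      ∃ λ xs → Enumerates (Level n ∘ lookup) xs × length xs ≡ k
    level-enumeration n (L , u , mem , len) = image coords ps , record
        { unique   = image-unique coords coords-inj ps u
        ; sound    = λ b∈ → let x , _ , p , e = ∈-image⁻ coords ps b∈ in
                       subst (Level n ∘ lookup) (sym e) (coords-Level x p)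
        ; complete = complete′
        } , trans (length-image coords ps) len
      where
      ps : All (InDilate v n) L
      ps = All.tabulate (λ {x} → proj₁ (mem x))
      -- Vectors, unlike functions, are equal as soon as all their entries are, so list membership
      -- can be tested entrywise.
      coords : ∀ x → InDilate v n x → Vec ℚ (suc d)
      coords _ (c , _) = tabulate c
      coords-Level : ∀ x (p : InDilate v n x) → Level n (lookup (coords x p))
      coords-Level x (c , nn , s , e) =
        Level-resp (sym ∘ lookup∘tabulate c) (mkLevel nn s (mkLattice (λ k → lookup x k , e k)))
      coords-inj : ∀ x y (p : InDilate v n x) (q : InDilate v n y) → coords x p ≡ coords y q → x ≡ y
      coords-inj x y (c , _ , _ , e) (c′ , _ , _ , e′) eq = lookup-ext (λ k →
        toℚ-injective {lookup x k} {lookup y k} (trans (sym (e k)) (trans (combination-cong c≡c′ k) (e′ k))))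
        where
        c≡c′ : ∀ i → c i ≡ c′ i
        c≡c′ i = trans (sym (lookup∘tabulate c i)) (trans (cong (λ xs → lookup xs i) eq) (lookup∘tabulate c′ i))
      complete′ : ∀ {l} → Level n (lookup l) → l ∈ image coords ps
      complete′ {l} (mkLevel nn s (mkLattice int)) =
          let p , p∈ = ∈-image⁺ coords ps x∈L in subst (_∈ image coords ps) (agree p) p∈
        where
        x : Point N
        x = tabulate (proj₁ ∘ int)
        combination≡ : ∀ k → combination (lookup l) k ≡ toℚ (lookup x k)
        combination≡ k = trans (proj₂ (int k)) (cong toℚ (sym (lookup∘tabulate (proj₁ ∘ int) k)))
        x∈L : x ∈ L
        x∈L = proj₂ (mem x) (lookup l , nn , s , combination≡)
        agree : (p : InDilate v n x) → coords x p ≡ l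
        agree (c , _ , s′ , e′) = lookup-ext (λ i → trans (lookup∘tabulate c i)
          (coords-unique c (lookup l) (trans s′ (sym s)) (λ k → trans (e′ k) (sym (combination≡ k))) i))

-- Counting box points

+[m+n]-+n : ∀ m n → + (m ℕ.+ n) ℤ.- + n ≡ + m
+[m+n]-+n m n = begin
  + (m ℕ.+ n) ℤ.- + n        ≡⟨ cong (ℤ._- + n) (ℤ.pos-+ m n) ⟩
  + m ℤ.+ + n ℤ.- + n        ≡⟨ ℤ.+-assoc (+ m) (+ n) (ℤ.- + n) ⟩
  + m ℤ.+ (+ n ℤ.- + n)      ≡⟨ cong (λ z → + m ℤ.+ z) (ℤ.+-inverseʳ (+ n)) ⟩
  + m ℤ.+ + 0                ≡⟨ ℤ.+-identityʳ (+ m) ⟩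
  + m                        ∎
  where open ≡-Reasoning

module _ {d N : ℕ} (v : Vertices d N) where

  open Lattice
  open Level

  Below : ℕ → Coords v → Set
  Below k c = ∀ i → toℕ i ℕ.< k → c i < 1ℚ

  Below? : ∀ k → Decidable (Below k)
  Below? k c = Fin.all? (λ i → (toℕ i ℕ.<? k) →-dec (c i ℚ.<? 1ℚ))

  _−_ _⊞_ : Coords v → Coords v → Coords v
  (c − c′) i = c i - c′ i
  (c ⊞ c′) i = c i + c′ i

  unit-cases : ∀ (κ i : Fin (suc d)) → (κ ≡ i × unit κ i ≡ 1ℚ) ⊎ (κ ≢ i × unit κ i ≡ 0ℚ)
  unit-cases κ i with κ Fin.≟ i
  ... | yes refl = inj₁ (refl , unit-diag κ)
  ... | no κ≢i   = inj₂ (κ≢i , unit-off-diag κ≢i)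

  -- Coordinate `κ` is at least 1 and so stays nonnegative; the coordinates before it do not change.
  shift-down : ∀ {n κ c} → Level v (suc n) c → Below (toℕ κ) c → ¬ (c κ < 1ℚ) →
    Level v n (c − unit κ) × Below (toℕ κ) (c − unit κ)
  shift-down {n} {κ} {c} l b c≮1 = mkLevel nn tot lat , below
    where
    nn : ∀ i → 0ℚ ≤ c i - unit κ i
    nn i with unit-cases κ i
    ... | inj₁ (refl , u≡1) = ≤⇒0≤- (subst (_≤ c κ) (sym u≡1) (ℚ.≮⇒≥ c≮1))
    ... | inj₂ (_ , u≡0)    = ≤⇒0≤- (subst (_≤ c i) (sym u≡0) (nonNegative l i))
    tot : Σℚ (c − unit κ) ≡ toℚ (+ n)
    tot = begin
      Σℚ (c − unit κ)             ≡⟨ Σℚ-distrib-- c (unit κ) ⟩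
      Σℚ c - Σℚ (unit κ)          ≡⟨ cong₂ _-_ (total l) (Σℚ-unit κ) ⟩
      toℚ (+ suc n) - 1ℚ          ≡⟨ cong (_- 1ℚ) (toℚ-homo-+ (+ 1) (+ n)) ⟩
      1ℚ + toℚ (+ n) - 1ℚ         ≡⟨ solve 2 (λ o x → o :+ x :- o := x) refl 1ℚ (toℚ (+ n)) ⟩
      toℚ (+ n)                   ∎
      where open ≡-Reasoning
    lat : Lattice v (c − unit κ)
    lat = Lattice-mod v (λ i → subst IsInt (solve 2 (λ x u → u := x :- (x :- u)) refl (c i) (unit κ i)) (unit-IsInt κ i)) (lattice l)
    below : Below (toℕ κ) (c − unit κ)
    below i i<κ with unit-cases κ i
    ... | inj₁ (refl , _)  = contradiction i<κ (ℕ.<-irrefl refl)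
    ... | inj₂ (_ , u≡0)   = subst (_< 1ℚ) (sym (trans (cong (λ u → c i - u) u≡0) (ℚ.+-identityʳ (c i)))) (b i i<κ)

  shift-up : ∀ {n κ c} → Level v n c → Below (toℕ κ) c →
    Level v (suc n) (c ⊞ unit κ) × Below (toℕ κ) (c ⊞ unit κ) × ¬ ((c ⊞ unit κ) κ < 1ℚ)
  shift-up {n} {κ} {c} l b = mkLevel nn tot lat , below , (λ <1 → ℚ.<-irrefl refl (ℚ.≤-<-trans 1≤ <1))
    where
    nn : ∀ i → 0ℚ ≤ c i + unit κ i
    nn i with unit-cases κ i
    ... | inj₁ (refl , u≡1) = subst (λ u → 0ℚ ≤ c i + u) (sym u≡1) (ℚ.+-mono-≤ (nonNegative l i) (ℚ.nonNegative⁻¹ 1ℚ))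
    ... | inj₂ (_ , u≡0)    = subst (λ u → 0ℚ ≤ c i + u) (sym u≡0) (subst (0ℚ ≤_) (sym (ℚ.+-identityʳ (c i))) (nonNegative l i))
    tot : Σℚ (c ⊞ unit κ) ≡ toℚ (+ suc n)
    tot = begin
      Σℚ (c ⊞ unit κ)             ≡⟨ Σℚ-distrib-+ c (unit κ) ⟩
      Σℚ c + Σℚ (unit κ)          ≡⟨ cong₂ _+_ (total l) (Σℚ-unit κ) ⟩
      toℚ (+ n) + 1ℚ              ≡⟨ ℚ.+-comm (toℚ (+ n)) 1ℚ ⟩
      1ℚ + toℚ (+ n)              ≡⟨ toℚ-homo-+ (+ 1) (+ n) ⟨
      toℚ (+ suc n)               ∎
      where open ≡-Reasoning
    lat : Lattice v (c ⊞ unit κ)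
    lat = Lattice-mod v (λ i → subst IsInt (solve 2 (λ x u → :- u := x :- (x :+ u)) refl (c i) (unit κ i)) (IsInt-neg (unit-IsInt κ i))) (lattice l)
    below : Below (toℕ κ) (c ⊞ unit κ)
    below i i<κ with unit-cases κ i
    ... | inj₁ (refl , _)  = contradiction i<κ (ℕ.<-irrefl refl)
    ... | inj₂ (_ , u≡0)   = subst (_< 1ℚ) (sym (trans (cong (λ u → c i + u) u≡0) (ℚ.+-identityʳ (c i)))) (b i i<κ)
    1≤ : 1ℚ ≤ c κ + unit κ κ
    1≤ = subst (λ u → 1ℚ ≤ c κ + u) (sym (unit-diag κ))
      (subst (_≤ c κ + 1ℚ) (ℚ.+-identityˡ 1ℚ) (ℚ.+-monoˡ-≤ 1ℚ (nonNegative l κ)))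

  Below-resp : ∀ {k c c′} → (∀ i → c i ≡ c′ i) → Below k c → Below k c′
  Below-resp e b i i<k = subst (_< 1ℚ) (e i) (b i i<k)

  tabulate-injective : ∀ {f : ℚ → ℚ → ℚ} {P : Vec ℚ (suc d) → Set} (c : Coords v) →
    (∀ i {l l′} → P l → P l′ → f (lookup l i) (c i) ≡ f (lookup l′ i) (c i) → lookup l i ≡ lookup l′ i) →
    InjectiveOn P (λ l → tabulate (λ i → f (lookup l i) (c i)))
  tabulate-injective {f} c inj {l} {l′} p p′ e = lookup-ext (λ i → inj i p p′
    (trans (sym (lookup∘tabulate (λ i → f (lookup l i) (c i)) i))
      (trans (cong (λ xs → lookup xs i) e) (lookup∘tabulate (λ i → f (lookup l′ i) (c i)) i))))

  module Counting (Λ : ℕ → List (Vec ℚ (suc d))) (Λ-enum : ∀ n → Enumerates (Level v n ∘ lookup) (Λ n)) where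

    Λ< : ℕ → ℕ → List (Vec ℚ (suc d))
    Λ< k n = filter (λ l → Below? k (lookup l)) (Λ n)

    Λ<-enum : ∀ k n → Enumerates (λ l → Level v n (lookup l) × Below k (lookup l)) (Λ< k n)
    Λ<-enum k n = filter-enumerates (λ l → Below? k (lookup l)) (Λ-enum n)

    Λ<-zero : ∀ n → length (Λ< 0 n) ≡ length (Λ n)
    Λ<-zero n = enumerated-length (Λ<-enum 0 n) (Λ-enum n) proj₁ (λ l → l , λ _ ())

    Λ<-level0 : ∀ k → length (Λ< k 0) ≡ length (Λ 0)
    Λ<-level0 k = enumerated-length (Λ<-enum k 0) (Λ-enum 0) proj₁
      (λ l → l , λ i _ → subst (_< 1ℚ) (sym (Level0⇒≡0 v l i)) (ℚ.positive⁻¹ 1ℚ))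

    -- The points are split by whether coordinate `κ` is below 1. If so, one more coordinate is
    -- bounded; if not, `shift-down` and `shift-up` match them with the points one level lower.
    Λ<-step : ∀ (κ : Fin (suc d)) n →
      length (Λ< (toℕ κ) (suc n)) ≡ length (Λ< (suc (toℕ κ)) (suc n)) ℕ.+ length (Λ< (toℕ κ) n)
    Λ<-step κ n = trans (length-filter-split κ<1? (Λ< k (suc n))) (cong₂ ℕ._+_ small large)
      where
      k = toℕ κ
      κ<1? : Decidable (λ (l : Vec ℚ (suc d)) → lookup l κ < 1ℚ)
      κ<1? l = lookup l κ ℚ.<? 1ℚ
      extend : ∀ {c} → Below k c → c κ < 1ℚ → Below (suc k) c
      extend {c} b c<1 i i<1+k with ℕ.m<1+n⇒m<n∨m≡n i<1+k
      ... | inj₁ i<k = b i i<k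
      ... | inj₂ i≡k = subst (λ i → c i < 1ℚ) (sym (Fin.toℕ-injective i≡k)) c<1
      small : length (filter κ<1? (Λ< k (suc n))) ≡ length (Λ< (suc k) (suc n))
      small = enumerated-length (filter-enumerates κ<1? (Λ<-enum k (suc n))) (Λ<-enum (suc k) (suc n))
        (λ ((l , b) , c<1) → l , extend b c<1)
        (λ (l , b) → (l , (λ i i<k → b i (ℕ.m<n⇒m<1+n i<k))) , b κ ℕ.≤-refl)
      large-enum = filter-enumerates (¬? ∘ κ<1?) (Λ<-enum k (suc n))
      large : length (filter (¬? ∘ κ<1?) (Λ< k (suc n))) ≡ length (Λ< k n)
      large = ℕ.≤-antisym
        (enumerated-injection-length large-enum (Λ<-enum k n) (λ l → tabulate (lookup l − unit κ))
          (λ {l} ((lv , b) , c≮1) → let e = sym ∘ lookup∘tabulate (lookup l − unit κ)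
                                        lv′ , b′ = shift-down lv b c≮1 in
            Level-resp v e lv′ , Below-resp e b′)
          (tabulate-injective {f = _-_} (unit κ) (λ i {l} {l′} _ _ e →
            trans (solve 2 (λ x u → x := x :- u :+ u) refl (lookup l i) (unit κ i))
              (trans (cong (_+ unit κ i) e) (solve 2 (λ x u → x :- u :+ u := x) refl (lookup l′ i) (unit κ i))))))
        (enumerated-injection-length (Λ<-enum k n) large-enum (λ l → tabulate (lookup l ⊞ unit κ))
          (λ {l} (lv , b) → let e = sym ∘ lookup∘tabulate (lookup l ⊞ unit κ)
                                lv′ , b′ , ≮1 = shift-up lv b in
            (Level-resp v e lv′ , Below-resp e b′) , ≮1 ∘ subst (_< 1ℚ) (sym (e κ)))
          (tabulate-injective {f = _+_} (unit κ) (λ i {l} {l′} _ _ e →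
            trans (solve 2 (λ x u → x := x :+ u :- u) refl (lookup l i) (unit κ i))
              (trans (cong (_- unit κ i) e) (solve 2 (λ x u → x :+ u :- u := x) refl (lookup l′ i) (unit κ i))))))

    module _ {e : ℕ → ℤ} (e≡ : ∀ n → e n ≡ + length (Λ n)) where

      -- Each `∇` bounds one more coordinate by 1. At level 0 `∇` changes nothing, and neither does
      -- the bound, since all coordinates vanish there.
      ∇^-Λ : ∀ k → k ℕ.≤ suc d → ∀ n → ∇^ k e n ≡ + length (Λ< k n)
      ∇^-Λ zero    _   n    = trans (e≡ n) (cong +_ (sym (Λ<-zero n)))
      ∇^-Λ (suc k) k<  zero = trans (∇^-Λ k (ℕ.<⇒≤ k<) zero)
        (cong +_ (trans (Λ<-level0 k) (sym (Λ<-level0 (suc k)))))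
      ∇^-Λ (suc k) k< (suc n) = begin
        ∇^ k e (suc n) ℤ.- ∇^ k e n
          ≡⟨ cong₂ ℤ._-_ (∇^-Λ k (ℕ.<⇒≤ k<) (suc n)) (∇^-Λ k (ℕ.<⇒≤ k<) n) ⟩
        + length (Λ< k (suc n)) ℤ.- + length (Λ< k n)
          ≡⟨ cong (λ m → + m ℤ.- + length (Λ< k n)) step ⟩
        + (length (Λ< (suc k) (suc n)) ℕ.+ length (Λ< k n)) ℤ.- + length (Λ< k n)
          ≡⟨ +[m+n]-+n (length (Λ< (suc k) (suc n))) (length (Λ< k n)) ⟩
        + length (Λ< (suc k) (suc n))
          ∎
        where
        open ≡-Reasoning
        step : length (Λ< k (suc n)) ≡ length (Λ< (suc k) (suc n)) ℕ.+ length (Λ< k n)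
        step = subst (λ k → length (Λ< k (suc n)) ≡ length (Λ< (suc k) (suc n)) ℕ.+ length (Λ< k n))
          (Fin.toℕ-fromℕ< k<) (Λ<-step (fromℕ< k<) n)

-- The group of box points

module _ {d N : ℕ} (v : Vertices d N) where

  open Lattice
  open Level

  -- The lattice points of the half-open parallelepiped spanned by the vectors `(v i, 1)`. The level
  -- is left free so that subtraction modulo 1 stays inside.
  record Box (c : Coords v) : Set where
    constructor mkBox
    field
      inUnit  : ∀ i → InUnit (c i)
      total∈ℤ : IsInt (Σℚ c)
      lattice : Lattice v c

  open Box

  Level⇒Box : ∀ {n c} → Level v n c → Below v (suc d) c → Box c
  Level⇒Box {n} l b = mkBox (λ i → nonNegative l i , b i (Fin.toℕ<n i)) (+ n , total l) (lattice l)

  -- The sum of `suc d` numbers in [0, 1) is less than `suc d`, so the levels up to `d` exhaust the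
  -- box points.
  Box⇒Level : ∀ {c} → Box c → ∃ λ n → n ℕ.≤ d × Level v n c × Below v (suc d) c
  Box⇒Level {c} (mkBox u s l) =
    n , ℕ.≤-pred (ℤ.drop‿+<+ (toℚ-cancel-< {+ n} {+ suc d} n<1+d)) ,
    mkLevel (proj₁ ∘ u) Σ≡n l , λ i _ → proj₂ (u i)
    where
    natural = nonNeg-IsInt s (Σℚ-nonNeg (proj₁ ∘ u))
    n = proj₁ natural
    Σ≡n : Σℚ c ≡ toℚ (+ n)
    Σ≡n = proj₂ natural
    n<1+d : toℚ (+ n) < toℚ (+ suc d)
    n<1+d = subst₂ _<_ Σ≡n (Σℚ-1 (suc d)) (Σℚ-mono-< (proj₂ ∘ u))

  Box-resp : ∀ {c c′} → (∀ i → c i ≡ c′ i) → Box c → Box c′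
  Box-resp e (mkBox u s l) = mkBox (λ i → subst InUnit (e i) (u i)) (subst IsInt (Σℚ-cong e) s) (Lattice-resp v e l)

  -- Replacing `-` by `⊖` changes each coordinate by an integer, which affects neither the
  -- integrality of the total nor that of the combination.
  Box-⊖ : ∀ {c c′} → Box c → Box c′ → Box (λ i → c i ⊖ c′ i)
  Box-⊖ {c} {c′} (mkBox u s l) (mkBox u′ s′ l′) = mkBox
    (λ i → ⊖-InUnit (u i) (u′ i))
    (IsInt-Σ-mod (λ i → c i - c′ i) (λ i → c i ⊖ c′ i) (λ i → ⊖-IsInt (c i) (c′ i))
      (subst IsInt (sym (Σℚ-distrib-- c c′)) (IsInt-- s s′)))
    (Lattice-mod v (λ i → ⊖-IsInt (c i) (c′ i)) (Lattice-- v l l′))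

  Box-0 : Box (λ _ → 0ℚ)
  Box-0 = Level⇒Box (≡0⇒Level0 v (λ _ → refl)) (λ _ _ → ℚ.positive⁻¹ 1ℚ)

  opposite : Coords v → Coords v
  opposite c i = 0ℚ ⊖ c i

  Box-opposite : ∀ {c} → Box c → Box (opposite c)
  Box-opposite = Box-⊖ Box-0

  opposite≡0⇒≡0 : ∀ {c} → Box c → ∀ i → opposite c i ≡ 0ℚ → c i ≡ 0ℚ
  opposite≡0⇒≡0 box i e = ⊖-injectiveʳ {0ℚ} (inUnit box i) (inUnit Box-0 i) e

  opposite-total : ∀ {m n c} → Level v n c → Level v m (opposite c) →
    Σℚ (λ i → c i + opposite c i) ≡ toℚ (+ (n ℕ.+ m))
  opposite-total {m} {n} {c} l l′ = trans (Σℚ-distrib-+ c (opposite c))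
    (trans (cong₂ _+_ (total l) (total l′)) (sym (toℚ-homo-+ (+ n) (+ m))))

  +opposite : ∀ {q} → 0ℚ ≤ q → q ≢ 0ℚ → q + (0ℚ ⊖ q) ≡ 1ℚ
  +opposite {q} 0≤q q≢0 = trans (cong (λ x → q + x) (⊖-zeroˡ 0≤q q≢0))
    (solve 2 (λ o q → q :+ (o :- q) := o) refl 1ℚ q)

  -- Each of the `suc d` coordinates contributes 1, since a nonzero coordinate and its opposite add
  -- up to 1.
  opposite-level-full : ∀ {m n c} → Level v n c → Level v m (opposite c) → (∀ i → c i ≢ 0ℚ) → n ℕ.+ m ≡ suc d
  opposite-level-full {m} {n} l l′ full = ℤ.+-injective (toℚ-injective {+ (n ℕ.+ m)} {+ suc d}
    (trans (sym (opposite-total l l′))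
      (trans (Σℚ-cong (λ i → +opposite (nonNegative l i) (full i))) (Σℚ-1 (suc d)))))

  -- A coordinate and its opposite add up to 0 or 1, and to 0 at `κ`. So the sum is bounded termwise
  -- by `1ℚ - unit κ i`, whose total is `d`.
  opposite-level-zero : ∀ {m n c} → Level v n c → Level v m (opposite c) → (κ : Fin (suc d)) → c κ ≡ 0ℚ → n ℕ.+ m ℕ.≤ d
  opposite-level-zero {m} {n} {c} l l′ κ cκ≡0 = ℤ.drop‿+≤+ (toℚ-cancel-≤ {+ (n ℕ.+ m)} {+ d}
    (subst₂ _≤_ (opposite-total l l′) bound (Σℚ-mono-≤ pointwise)))
    where
    bound : Σℚ (λ i → 1ℚ - unit κ i) ≡ toℚ (+ d)
    bound = begin
      Σℚ (λ i → 1ℚ - unit κ i)          ≡⟨ Σℚ-distrib-- (λ _ → 1ℚ) (unit κ) ⟩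
      Σℚ {suc d} (λ _ → 1ℚ) - Σℚ (unit κ) ≡⟨ cong₂ _-_ (Σℚ-1 (suc d)) (Σℚ-unit κ) ⟩
      toℚ (+ suc d) - 1ℚ                ≡⟨ cong (_- 1ℚ) (toℚ-homo-+ (+ 1) (+ d)) ⟩
      1ℚ + toℚ (+ d) - 1ℚ               ≡⟨ solve 2 (λ o x → o :+ x :- o := x) refl 1ℚ (toℚ (+ d)) ⟩
      toℚ (+ d)                         ∎
      where open ≡-Reasoning
    zero≡ : ∀ {q} → q ≡ 0ℚ → q + (0ℚ ⊖ q) ≡ 0ℚ
    zero≡ refl = refl
    pointwise : ∀ i → c i + opposite c i ≤ 1ℚ - unit κ i
    pointwise i with unit-cases v κ i | c i ℚ.≟ 0ℚ
    ... | inj₁ (refl , u≡1) | _ = ℚ.≤-reflexive (trans (zero≡ cκ≡0) (sym (trans (cong (λ u → 1ℚ - u) u≡1) (ℚ.+-inverseʳ 1ℚ))))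
    ... | inj₂ (_ , u≡0) | yes ci≡0 = subst₂ _≤_ (sym (zero≡ ci≡0)) (cong (λ u → 1ℚ - u) (sym u≡0)) (ℚ.nonNegative⁻¹ 1ℚ)
    ... | inj₂ (_ , u≡0) | no ci≢0 = ℚ.≤-reflexive (trans (+opposite (nonNegative l i) ci≢0) (cong (λ u → 1ℚ - u) (sym u≡0)))

  infixl 6 _⊖ᵛ_
  _⊖ᵛ_ : Vec ℚ (suc d) → Vec ℚ (suc d) → Vec ℚ (suc d)
  x ⊖ᵛ y = tabulate (λ i → lookup x i ⊖ lookup y i)

  lookup-⊖ᵛ : ∀ x y i → lookup (x ⊖ᵛ y) i ≡ lookup x i ⊖ lookup y i
  lookup-⊖ᵛ x y = lookup∘tabulate (λ i → lookup x i ⊖ lookup y i)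

  BoxVec : Vec ℚ (suc d) → Set
  BoxVec l = Box (lookup l)

  BoxVec-⊖ᵛ : ∀ x y → BoxVec x → BoxVec y → BoxVec (x ⊖ᵛ y)
  BoxVec-⊖ᵛ x y bx by = Box-resp (sym ∘ lookup-⊖ᵛ x y) (Box-⊖ bx by)

  ⊖ᵛ-injectiveˡ : ∀ z → InjectiveOn BoxVec (λ x → x ⊖ᵛ z)
  ⊖ᵛ-injectiveˡ z {x} {y} bx by e = lookup-ext (λ i → ⊖-injectiveˡ {r = lookup z i} (inUnit bx i) (inUnit by i)
    (trans (sym (lookup-⊖ᵛ x z i)) (trans (cong (λ w → lookup w i) e) (lookup-⊖ᵛ y z i))))

  ⊖ᵛ-injectiveʳ : ∀ z → InjectiveOn BoxVec (λ x → z ⊖ᵛ x)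
  ⊖ᵛ-injectiveʳ z {x} {y} bx by e = lookup-ext (λ i → ⊖-injectiveʳ {lookup z i} (inUnit bx i) (inUnit by i)
    (trans (sym (lookup-⊖ᵛ z x i)) (trans (cong (λ w → lookup w i) e) (lookup-⊖ᵛ z y i))))

  0ᵛ : Vec ℚ (suc d)
  0ᵛ = tabulate (λ _ → 0ℚ)

  lookup-0ᵛ : ∀ i → lookup 0ᵛ i ≡ 0ℚ
  lookup-0ᵛ = lookup∘tabulate (λ _ → 0ℚ)

  BoxVec-0ᵛ : BoxVec 0ᵛ
  BoxVec-0ᵛ = Box-resp (sym ∘ lookup-0ᵛ) Box-0

  module _ {G : List (Vec ℚ (suc d))} (G-enum : Enumerates BoxVec G) where

    vanishing : Fin (suc d) → List (Vec ℚ (suc d))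
    vanishing κ = filter (λ l → lookup l κ ℚ.≟ 0ℚ) G

    vanishing-enum : ∀ κ → Enumerates (λ l → BoxVec l × lookup l κ ≡ 0ℚ) (vanishing κ)
    vanishing-enum κ = filter-enumerates (λ l → lookup l κ ℚ.≟ 0ℚ) G-enum

    -- Lagrange's theorem: the fibres of the `κ`-th coordinate are the cosets of the subgroup
    -- vanishing there, and subtraction gives injections both ways between a coset and the subgroup.
    vanishing-divides : ∀ κ → length (vanishing κ) ∣ length G
    vanishing-divides κ = equal-fibres-divide ℚ._≟_ (λ l → lookup l κ) (length (vanishing κ)) G coset
      where
      coset : ∀ {x} → x ∈ G → length (fibre ℚ._≟_ (λ l → lookup l κ) x G) ≡ length (vanishing κ)
      coset {x} x∈ = ℕ.≤-antisym
        (enumerated-injection-length fibre-enum (vanishing-enum κ) (λ y → y ⊖ᵛ x)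
          (λ {y} (by , yκ≡xκ) → BoxVec-⊖ᵛ y x by bx ,
            trans (lookup-⊖ᵛ y x κ) (trans (cong (_⊖ lookup x κ) yκ≡xκ) (⊖-self (lookup x κ))))
          (λ (by , _) (bz , _) → ⊖ᵛ-injectiveˡ x by bz))
        -- `x ⊖ᵛ y` takes the place of the sum of `x` and `y`: both lie in the coset of `x` when `y`
        -- vanishes at `κ`.
        (enumerated-injection-length (vanishing-enum κ) fibre-enum (λ y → x ⊖ᵛ y)
          (λ {y} (by , yκ≡0) → BoxVec-⊖ᵛ x y bx by ,
            trans (lookup-⊖ᵛ x y κ) (trans (cong (lookup x κ ⊖_) yκ≡0) (⊖-zeroʳ (proj₁ (inUnit bx κ)))))
          (λ (by , _) (bz , _) → ⊖ᵛ-injectiveʳ x by bz))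
        where
        bx : BoxVec x
        bx = sound G-enum x∈
        fibre-enum : Enumerates (λ y → BoxVec y × lookup y κ ≡ lookup x κ) (fibre ℚ._≟_ (λ l → lookup l κ) x G)
        fibre-enum = filter-enumerates (λ y → lookup y κ ℚ.≟ lookup x κ) G-enum

    -- The order of the subgroup vanishing at `κ` divides a prime, and `x` lies outside this
    -- subgroup; so its order is 1 and it contains only `0ᵛ`.
    prime-support : Prime (length G) → ∀ κ x y → BoxVec x → lookup x κ ≢ 0ℚ →
      BoxVec y → lookup y κ ≡ 0ℚ → y ≡ 0ᵛ
    prime-support pr κ x y bx xκ≢0 by yκ≡0 = [ trivial , everything ]′ (prime⇒irreducible pr (vanishing-divides κ))
      where
      trivial : length (vanishing κ) ≡ 1 → y ≡ 0ᵛ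
      trivial ≡1 = length≡1⇒≡ ≡1 (complete (vanishing-enum κ) (by , yκ≡0))
        (complete (vanishing-enum κ) (BoxVec-0ᵛ , lookup-0ᵛ κ))
      everything : length (vanishing κ) ≡ length G → y ≡ 0ᵛ
      everything ≡p = contradiction (proj₂ (sound (vanishing-enum κ) x∈)) xκ≢0
        where
        x∈ : x ∈ vanishing κ
        x∈ = subst (x ∈_) (sym (filter-complete (λ l → lookup l κ ℚ.≟ 0ℚ) ≡p)) (complete G-enum bx)

-- Symmetry of the box point counts

level-lists : ∀ {d N} (v : Vertices d N) → AffinelyIndependent v → (i : ℕ → ℕ) →
  (∀ n → LatticeCount v (suc n) (i (suc n))) →
  ∀ n → ∃ λ xs → Enumerates (Level v n ∘ lookup) xs × ehrCoeff i n ≡ + length xs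
-- The given counts start at the first dilate. Level 0 consists of the zero tuple alone, in
-- agreement with the constant term 1 of `ehrCoeff`.
level-lists v indep i counts zero = 0ᵛ v ∷ [] , record
  { unique   = All.[] ∷ []
  ; sound    = λ { (here refl) → ≡0⇒Level0 v (lookup-0ᵛ v) }
  ; complete = λ l → here (lookup-ext (λ i → trans (Level0⇒≡0 v l i) (sym (lookup-0ᵛ v i))))
  } , refl
level-lists v indep i counts (suc n) =
  let xs , ex , len = level-enumeration v indep (suc n) (counts n) in xs , ex , cong +_ (sym len)

module Symmetry {d N : ℕ} (v : Vertices d N)
  (Λ : ℕ → List (Vec ℚ (suc d))) (Λ-enum : ∀ n → Enumerates (Level v n ∘ lookup) (Λ n)) where

  open Counting v Λ Λ-enum
  open Level
  open Box

  box : ℕ → List (Vec ℚ (suc d))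
  box = Λ< (suc d)

  box-enum : ∀ n → Enumerates (λ l → Level v n (lookup l) × Below v (suc d) (lookup l)) (box n)
  box-enum = Λ<-enum (suc d)

  G : List (Vec ℚ (suc d))
  G = concatUpTo box d

  G-enum : Enumerates (BoxVec v) G
  G-enum = enumerates-resp (λ (_ , _ , l , b) → Level⇒Box v l b) (Box⇒Level v)
    (concatUpTo-enumerates (λ (l , _) (l′ , _) → Level-unique v l l′) box-enum d)

  −ᵛ_ : Vec ℚ (suc d) → Vec ℚ (suc d)
  −ᵛ x = tabulate (opposite v (lookup x))

  lookup-−ᵛ : ∀ x i → lookup (−ᵛ x) i ≡ opposite v (lookup x) i
  lookup-−ᵛ x = lookup∘tabulate (opposite v (lookup x))

  −ᵛ-injective : InjectiveOn (BoxVec v) −ᵛ_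
  −ᵛ-injective {x} {y} bx by e = lookup-ext (λ i → ⊖-injectiveʳ {0ℚ} (inUnit bx i) (inUnit by i)
    (trans (sym (lookup-−ᵛ x i)) (trans (cong (λ w → lookup w i) e) (lookup-−ᵛ y i))))

  module _ (G-prime : Prime (length G)) {a b : ℕ}
    (a≤d : a ℕ.≤ d) (0<a : 0 ℕ.< a) (a-nonempty : length (box a) ≢ 0)
    (a-min : ∀ j → 0 ℕ.< j → j ℕ.< a → length (box j) ≡ 0)
    (b-nonempty : length (box b) ≢ 0)
    (b-max : ∀ j → b ℕ.< j → j ℕ.≤ d → length (box j) ≡ 0)
    (a≡ : a ≡ suc d ∸ b) where

    0<b : 0 ℕ.< b
    -- The nonempty level `a` cannot lie above the last nonempty level `b`, so `0 < a ≤ b`.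
    0<b = ℕ.<-≤-trans 0<a (ℕ.≮⇒≥ (λ b<a → a-nonempty (b-max a b<a a≤d)))

    top : Vec ℚ (suc d)
    top = proj₁ (length≢0⇒∃ (box b) b-nonempty)

    top-sound : Level v b (lookup top) × Below v (suc d) (lookup top)
    top-sound = sound (box-enum b) (proj₂ (length≢0⇒∃ (box b) b-nonempty))

    top-Box : BoxVec v top
    top-Box = Level⇒Box v (proj₁ top-sound) (proj₂ top-sound)

    top-full : ∀ κ → lookup top κ ≢ 0ℚ
    top-full κ topκ≡0 = length≡0⇒∉ (a-min m 0<m m<a)
        (complete (box-enum m) {−ᵛ top} (Level-resp v e level , Below-resp v e below))
      where
      e : ∀ i → opposite v (lookup top) i ≡ lookup (−ᵛ top) i
      e i = sym (lookup-−ᵛ top i)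
      found : ∃ λ m → m ℕ.≤ d × Level v m (opposite v (lookup top)) × Below v (suc d) (opposite v (lookup top))
      found = Box⇒Level v (Box-opposite v top-Box)
      m : ℕ
      m = proj₁ found
      level : Level v m (opposite v (lookup top))
      level = proj₁ (proj₂ (proj₂ found))
      below : Below v (suc d) (opposite v (lookup top))
      below = proj₂ (proj₂ (proj₂ found))
      m<a : m ℕ.< a
      -- The zero coordinate gives `b + m ≤ d`, so `suc m` is at most `suc d ∸ b`, which is `a`.
      m<a = subst (m ℕ.<_) (sym a≡) (ℕ.m+n≤o⇒m≤o∸n (suc m)
        (s≤s (subst (ℕ._≤ d) (ℕ.+-comm b m) (opposite-level-zero v (proj₁ top-sound) level κ topκ≡0))))
      0<m : 0 ℕ.< m
      -- If `m` were 0, the opposite of `top` and hence `top` itself would vanish, although its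
      -- level `b` is positive.
      0<m = ℕ.n≢0⇒n>0 (λ m≡0 → ℕ.<⇒≢ 0<b (sym (Level-unique v (proj₁ top-sound)
        (≡0⇒Level0 v (λ i → opposite≡0⇒≡0 v top-Box i
          (Level0⇒≡0 v (subst (λ m → Level v m (opposite v (lookup top))) m≡0 level) i))))))

    -- As `top` vanishes nowhere, `prime-support` applies at every `κ`: a point with a zero
    -- coordinate is `0ᵛ` and has level 0.
    full : ∀ n x → 0 ℕ.< n → Level v n (lookup x) → BoxVec v x → ∀ κ → lookup x κ ≢ 0ℚ
    full n x 0<n l bx κ xκ≡0 = ℕ.<⇒≢ 0<n (sym (Level-unique v l (≡0⇒Level0 v (λ i →
      trans (cong (λ w → lookup w i) (prime-support v G-enum G-prime κ top x top-Box (top-full κ) bx xκ≡0)) (lookup-0ᵛ v i)))))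

    -- Negation is injective on box points. A positive level makes all coordinates nonzero, which
    -- fixes the level of the opposite by `opposite-level-full`.
    box-≤ : ∀ n → 0 ℕ.< n → length (box n) ℕ.≤ length (box (suc d ∸ n))
    box-≤ n 0<n = enumerated-injection-length (box-enum n) (box-enum (suc d ∸ n)) −ᵛ_ (λ {x} → into x)
      (λ {x} {y} (l , b) (l′ , b′) → −ᵛ-injective {x} {y} (Level⇒Box v l b) (Level⇒Box v l′ b′))
      where
      into : ∀ x → Level v n (lookup x) × Below v (suc d) (lookup x) →
        Level v (suc d ∸ n) (lookup (−ᵛ x)) × Below v (suc d) (lookup (−ᵛ x))
      into x (l , b) = Level-resp v e (subst (λ m → Level v m (opposite v (lookup x))) m≡ level) , Below-resp v e below
        where
        e : ∀ i → opposite v (lookup x) i ≡ lookup (−ᵛ x) i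
        e i = sym (lookup-−ᵛ x i)
        bx : BoxVec v x
        bx = Level⇒Box v l b
        found : ∃ λ m → m ℕ.≤ d × Level v m (opposite v (lookup x)) × Below v (suc d) (opposite v (lookup x))
        found = Box⇒Level v (Box-opposite v bx)
        m : ℕ
        m = proj₁ found
        level : Level v m (opposite v (lookup x))
        level = proj₁ (proj₂ (proj₂ found))
        below : Below v (suc d) (opposite v (lookup x))
        below = proj₂ (proj₂ (proj₂ found))
        m≡ : m ≡ suc d ∸ n
        m≡ = trans (sym (ℕ.m+n∸m≡n n m)) (cong (_∸ n) (opposite-level-full v l level (full n x 0<n l bx)))

    -- The levels `d ∸ j` and `suc j` are both positive and add up to `suc d`, so `box-≤` bounds
    -- each count by the other.
    box-symmetric : ∀ j → j ℕ.< d → length (box (d ∸ j)) ≡ length (box (suc j))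
    box-symmetric j j<d = ℕ.≤-antisym
      (subst (λ n → length (box (d ∸ j)) ℕ.≤ length (box n)) flip (box-≤ (d ∸ j) (ℕ.m<n⇒0<n∸m j<d)))
      (box-≤ (suc j) (s≤s z≤n))
      where
      flip : suc d ∸ (d ∸ j) ≡ suc j
      flip = trans (ℕ.+-∸-assoc 1 (ℕ.m∸n≤m d j)) (cong suc (ℕ.m∸[m∸n]≡n (ℕ.<⇒≤ j<d)))

theorem2p2 : (d N : ℕ) (v : Vertices d N) → AffinelyIndependent v →
    (i : ℕ → ℕ) → ((n : ℕ) → LatticeCount v (suc n) (i (suc n))) →
    (p : ℕ) → Prime p → normVol d i ≡ + p →
    (Σ ℕ λ a → Σ ℕ λ b → IsMinPosNonzero d (delta d i) a × IsMaxNonzero d (delta d i) b × a ≡ suc d ∸ b) →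
    ShiftedSymmetric d (delta d i)
theorem2p2 d N v indep i counts p p-prime vol
  (a , b , (0<a , a≤d , δa≢0 , a-min) , (_ , δb≢0 , b-max) , a≡) j 2j<d =
    trans (δ≡ (d ∸ j)) (trans (cong +_ symmetric) (sym (δ≡ (suc j))))
  where
  lists = level-lists v indep i counts
  Λ : ℕ → List (Vec ℚ (suc d))
  Λ n = proj₁ (lists n)
  Λ-enum : ∀ n → Enumerates (Level v n ∘ lookup) (Λ n)
  Λ-enum n = proj₁ (proj₂ (lists n))
  open Counting v Λ Λ-enum
  open Symmetry v Λ Λ-enum
  δ≡ : ∀ n → delta d i n ≡ + length (box n)
  δ≡ n = trans (delta-∇ d i n) (∇^-Λ (λ n → proj₂ (proj₂ (lists n))) (suc d) ℕ.≤-refl n)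
  nonempty : ∀ n → ¬ (delta d i n ≡ + 0) → length (box n) ≢ 0
  nonempty n δ≢0 e = δ≢0 (trans (δ≡ n) (cong +_ e))
  empty : ∀ n → delta d i n ≡ + 0 → length (box n) ≡ 0
  empty n δ≡0 = ℤ.+-injective (trans (sym (δ≡ n)) δ≡0)
  length-G : length G ≡ p
  -- The normalized volume is the sum of the δ's, hence the number of box points, so the group has
  -- prime order.
  length-G = ℤ.+-injective (trans (length-concatUpTo box d) (trans (sym (Σℤ-cong d δ≡)) vol))
  symmetric : length (box (d ∸ j)) ≡ length (box (suc j))
  symmetric = box-symmetric (subst Prime (sym length-G) p-prime) a≤d 0<a (nonempty a δa≢0)
    (λ j 0<j j<a → empty j (a-min j 0<j j<a)) (nonempty b δb≢0) (λ j b<j j≤d → empty j (b-max j b<j j≤d)) a≡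
    -- `suc (2 * j) ≤ d` implies `j < d`, the range of `box-symmetric`.
    j (ℕ.≤-trans (s≤s (ℕ.m≤m+n j (j ℕ.+ 0))) 2j<d)
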